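{- Let $TS=(V,a,Init,Tr)$ be a deterministic transition system (whose set of labels $\mathcal L$ may be infinite), let $\varphi=\psi\rightarrow\forall\pi_1:\xi_1,\ldots,\pi_l:\xi_l\cdot\exists\pi_{l+1}:\xi_{l+1},\ldots,\pi_k:\xi_k\cdot\square\phi$, and let $\mathcal L^\sharp$ be a finite set of $\Sigma$-formulas with free variables in $\mathcal V$ (abstract labels). Let $U=S\times\mathcal L^\sharp$. Consider the following set of constrained Horn clauses over the unknown predicates $\{D_{M,p}(\mathcal V,\mathbf a^\forall)\}_{(M,p)\in U}$: \begin{align*} &\textstyle\bigwedge_{(M,p)\in U}D_{M,p}(\mathcal V,\mathbf a^\forall)\wedge\bigwedge_{i=1}^k Init(V_i)\wedge\psi(\mathcal V)\to\bot\\ &Bad(\mathcal V)\to D_{M,p}(\mathcal V,\mathbf a^\forall)\qquad\text{for every }(M,p)\in U\\ &\neg valid_M(\mathcal V)\to D_{M,p}(\mathcal V,\mathbf a^\forall)\qquad\text{for every }(M,p)\in U\\ &\textstyle\bigwedge_{(M',p')\in U}D_{M',p'}(\mathcal V',\mathbf a'^\forall)\wedge\delta_{M,p}(\mathcal V,\mathcal V',\mathbf a^\forall)\to D_{M,p}(\mathcal V,\mathbf a^\forall)\qquad\text{for every }(M,p)\in U \end{align*} If this set of CHCs is satisfiable, then $TS\models_G\varphi$ (i.e. $TS$ satisfies $\varphi$ according to the game semantics).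
   Context: Background. Fix a many-sorted first-order theory $\mathcal T$ over signature $\Sigma$ with its intended model; valuations of variables take values in this model, and a set of formulas over $\Sigma$ and unknown (uninterpreted) predicates is satisfiable if the unknown predicates can be interpreted as relations over this model so that all the formulas (with all free variables universally quantified) hold. Transition systems. $TS=(V,a,Init,Tr)$: $V$ is a finite vector of sorted state variables, $a$ a label variable, $Init$ a $\Sigma$-formula over $V$, $Tr$ a $\Sigma$-formula over $V\cup\{a\}\cup V'$ ($V'$ a primed copy of $V$). States are valuations of $V$ (set $\mathcal S$), labels are the values of $a$ (set $\mathcal L$), initial states are those satisfying $Init$, and $R\subseteq\mathcal S\times\mathcal L\times\mathcal S$ is the set of valuations satisfying $Tr$. $TS$ is deterministic if for every $s\in\mathcal S$ and $\ell\in\mathcal L$ there is exactly one $s'$ with $(s,\ell,s')\in R$. Formula $\varphi$. $k\ge1$, $0\le l\le k$; each $\xi_i$ is a $\Sigma$-formula over $V$; $\psi,\phi$ are $\Sigma$-formulas over $\mathcal V=V_1\cup\dots\cup V_k$, where $V_j$ is the copy of $V$ indexed by $j$. A composed state $\bar s=(s_1,\ldots,s_k)\in\mathcal S^k$ is a valuation of $\mathcal V$. Schedules. $S=\mathcal P(\{1,\ldots,k\})\setminus\{\varnothing\}$. $M\in S$ is valid for $\bar s$ if either $s_i\not\models\xi_i$ for all $i\in M$, or $M=\{1,\ldots,k\}$ and $s_i\models\xi_i$ for all $i$. For $\bar\ell\in\mathcal L^k$, write $\bar s\overset{M,\bar\ell}{\rightsquigarrow}\bar s'$ iff $(s_i,\ell_i,s_i')\in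 R$ for all $i\in M$ and $s_i'=s_i$ for all $i\notin M$. Game semantics. The verification game has falsifier states $\mathcal S^k$; verifier states $\mathcal S^k\times\mathcal L^l$; initial states: the $\bar s$ with all $s_i$ initial and $\bar s\models\psi$; bad states: the falsifier states $\bar s$ with $s_i\models\xi_i$ for all $1\le i\le k$ and $\bar s\not\models\phi$. From falsifier state $\bar s$ the falsifier may move to $(\bar s,\bar\ell^\forall)$ for any $\bar\ell^\forall\in\mathcal L^l$. From verifier state $(\bar s,\bar\ell^\forall)$ the verifier may move to any $\bar s'$ such that $\bar s\overset{M,\bar\ell}{\rightsquigarrow}\bar s'$ for some $M$ valid for $\bar s$ and some $\bar\ell=\bar\ell^\forall\bar\ell^\exists$ (concatenation) with $\bar\ell^\exists\in\mathcal L^{k-l}$. A play is a sequence of game states starting from an initial state with consecutive states related by moves; it is winning for the verifier if it is infinite and visits no bad state. A (memoryless) verifier strategy maps each verifier state to a successor allowed by a verifier move; it is winning if all plays in which the verifier follows it are winning for the verifier. $TS\models_G\varphi$ iff the verifier has a winning strategy. Formulas. $\mathbf a^\forall=\langle a_1,\ldots,a_l\rangle$, $\mathbf a^\exists=\langle a_{l+1},\ldots,a_k\rangle$ are copies of the label variable, $\mathbf a=\langle a_1,\ldots,a_k\rangle$, and $\mathbf a'^\forall$ is a fresh (primed) copy of $\mathbf a^\forall$. $Bad(\mathcal V)=\bigwedge_{i=1}^k\xi_i(V_i)\wedge\neg\phi(\mathcal V)$. $valid_M(\mathcal V)=\bigwedge_{i\in M}\neg\xi_i(V_i)$ if $M\ne\{1,\ldots,k\}$,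 and $\big(\bigwedge_{i\in M}\neg\xi_i(V_i)\big)\vee\big(\bigwedge_{i\in M}\xi_i(V_i)\big)$ if $M=\{1,\ldots,k\}$. $\Delta_M(\mathcal V,\mathcal V',\mathbf a)=\bigwedge_{i\in M}Tr(V_i,a_i,V_i')\wedge\bigwedge_{i\notin M}V_i=V_i'$. For $p\in\mathcal L^\sharp$: $allowed_{M,p}(\mathcal V,\mathbf a^\forall)=\exists\mathcal V',\mathbf a^\exists\cdot\Delta_M(\mathcal V,\mathcal V',\mathbf a)\wedge p(\mathcal V')$ and $\delta_{M,p}(\mathcal V,\mathcal V',\mathbf a^\forall)=\big(\exists\mathbf a^\exists\cdot\Delta_M(\mathcal V,\mathcal V',\mathbf a)\big)\wedge\big(allowed_{M,p}(\mathcal V,\mathbf a^\forall)\to p(\mathcal V')\big)$. -}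

module Defs where

open import Level using (Level; suc; _⊔_; Lift)
open import Data.Bool.Base using (if_then_else_)
import Data.Bool.Properties as Bool
open import Data.Empty using (⊥)
open import Data.Fin.Base using (Fin; zero; inject₁; fromℕ) renaming (suc to fsuc)
open import Data.Fin.Subset using (Subset; Nonempty; _∈_; _∉_) renaming (⊤ to full)
open import Data.List.Base using (List; []; _∷_; _++_; concat; replicate)
import Data.List.Membership.Propositional as List
open import Data.List.Relation.Unary.All using (All; []; _∷_) renaming (lookup to lookupAll)
open import Data.List.Relation.Unary.All.Properties using (++⁺)
open import Data.Nat.Base using (ℕ; NonZero; _≤_; _∸_) renaming (suc to 1+)
open import Data.Nat.Properties using (m+[n∸m]≡n)
open import Data.Product using (Σ; ∃; ∃-syntax; ∃!; _×_; _,_; proj₁)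
open import Data.Sum using (_⊎_)
open import Data.Vec.Base as Vec using (Vec; []; _∷_; lookup; cast)
import Data.Vec.Properties as Vec
open import Relation.Binary.PropositionalEquality using (_≡_)
open import Relation.Nullary using (¬_; Dec; does)

------------------------------------------------------------------------
-- Many-sorted first-order logic with equality

record Signature : Set₁ where
  field
    Sort : Set
    Fun  : List Sort → Sort → Set
    Rel  : List Sort → Set

module _ (Sg : Signature) where
  open Signature Sg

  -- A context lists the sorts of the free variables; a variable is a
  -- position in it.
  Context : Set
  Context = List Sort

  data Term (Γ : Context) : Sort → Set where
    var : ∀ {s} → s List.∈ Γ → Term Γ s
    fun : ∀ {ss s} → Fun ss s → All (Term Γ) ss → Term Γ s

  infixr 6 _∧′_
  infixr 5 _∨′_
  infixr 4 _⇒′_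

  data Formula (Γ : Context) : Set where
    rel  : ∀ {ss} → Rel ss → All (Term Γ) ss → Formula Γ
    _≈′_ : ∀ {s} → Term Γ s → Term Γ s → Formula Γ
    ⊥′   : Formula Γ
    _∧′_ _∨′_ _⇒′_ : Formula Γ → Formula Γ → Formula Γ
    ∀′ ∃′ : (s : Sort) → Formula (s ∷ Γ) → Formula Γ

  -- As usual in first-order logic, every sort has a nonempty domain.
  record Structure (ℓ : Level) : Set (suc ℓ) where
    field
      Carrier   : Sort → Set ℓ
      inhabited : ∀ s → Carrier s
      ⟦_⟧ᶠ      : ∀ {ss s} → Fun ss s → All Carrier ss → Carrier s
      ⟦_⟧ʳ      : ∀ {ss} → Rel ss → All Carrier ss → Set ℓ

    Valuation : Context → Set ℓ
    Valuation = All Carrier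

    mutual
      eval : ∀ {Γ s} → Valuation Γ → Term Γ s → Carrier s
      eval ρ (var x)    = lookupAll ρ x
      eval ρ (fun f ts) = ⟦ f ⟧ᶠ (evals ρ ts)

      evals : ∀ {Γ ss} → Valuation Γ → All (Term Γ) ss → All Carrier ss
      evals ρ []       = []
      evals ρ (t ∷ ts) = eval ρ t ∷ evals ρ ts

    infix 3 _⊨_

    _⊨_ : ∀ {Γ} → Valuation Γ → Formula Γ → Set ℓ
    ρ ⊨ rel r ts = ⟦ r ⟧ʳ (evals ρ ts)
    ρ ⊨ t ≈′ u   = eval ρ t ≡ eval ρ u
    ρ ⊨ ⊥′       = Lift ℓ ⊥
    ρ ⊨ A ∧′ B   = (ρ ⊨ A) × (ρ ⊨ B)
    ρ ⊨ A ∨′ B   = (ρ ⊨ A) ⊎ (ρ ⊨ B)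
    ρ ⊨ A ⇒′ B   = (ρ ⊨ A) → (ρ ⊨ B)
    ρ ⊨ ∀′ s A   = (x : Carrier s) → x ∷ ρ ⊨ A
    ρ ⊨ ∃′ s A   = Σ (Carrier s) λ x → x ∷ ρ ⊨ A

  record Theory (ℓ : Level) : Set (suc ℓ) where
    field
      Axiom    : Formula [] → Set
      intended : Structure ℓ
      isModel  : ∀ A → Axiom A → Structure._⊨_ intended [] A

  ----------------------------------------------------------------------
  -- Transition systems and properties

  record TransitionSystem : Set where
    field
      V    : Context
      a    : Sort
      Init : Formula V
      Tr   : Formula (V ++ a ∷ V)

  -- The context V₁ ∪ … ∪ Vₖ.
  copies : ℕ → Context → Context
  copies k V = concat (replicate k V)

  -- ψ → ∀ π₁ : ξ₁, …, πₗ : ξₗ · ∃ πₗ₊₁ : ξₗ₊₁, …, πₖ : ξₖ · □ ϕ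
  record Property (TS : TransitionSystem) : Set where
    open TransitionSystem TS
    field
      k l       : ℕ
      {{k≢0}}   : NonZero k
      l≤k       : l ≤ k
      ξ         : Fin k → Formula V
      ψ ϕ       : Formula (copies k V)

    AbstractLabel : Set
    AbstractLabel = Formula (copies k V)

------------------------------------------------------------------------
-- Semantics over the intended model

module Semantics {ℓ} {Sg : Signature} (𝒯 : Theory Sg ℓ) (TS : TransitionSystem Sg) where
  open Structure (Theory.intended 𝒯) public
  open TransitionSystem TS public

  State : Set ℓ
  State = Valuation V

  Label : Set ℓ
  Label = Carrier a

  R : State → Label → State → Set ℓ
  R s b s′ = ++⁺ s (b ∷ s′) ⊨ Tr

  Deterministic : Set ℓ
  Deterministic = ∀ s b → ∃! _≡_ λ s′ → R s b s′

  -- A composed state as a valuation of V₁ ∪ … ∪ Vₖ.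
  flatten : ∀ {k} → Vec State k → Valuation (copies Sg k V)
  flatten []       = []
  flatten (s ∷ s̄) = ++⁺ s (flatten s̄)

  infix 3 _⊨ᶜ_

  _⊨ᶜ_ : ∀ {k} → Vec State k → Formula Sg (copies Sg k V) → Set ℓ
  s̄ ⊨ᶜ A = flatten s̄ ⊨ A

open Semantics using (Deterministic) public

module Composition {ℓ} {Sg : Signature} (𝒯 : Theory Sg ℓ) (TS : TransitionSystem Sg)
                   (φ : Property Sg TS) where
  open Semantics 𝒯 TS public
  open Property φ public

  CState : Set ℓ
  CState = Vec State k

  Labels∀ : Set ℓ
  Labels∀ = Vec Label l

  Labels∃ : Set ℓ
  Labels∃ = Vec Label (k ∸ l)

  -- Concatenation; the cast only identifies l + (k ∸ l) with k.
  _⌢_ : Labels∀ → Labels∃ → Vec Label k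
  b∀ ⌢ b∃ = cast (m+[n∸m]≡n l≤k) (b∀ Vec.++ b∃)

  _≟full : (M : Subset k) → Dec (M ≡ full)
  M ≟full = Vec.≡-dec Bool._≟_ M full

  ----------------------------------------------------------------------
  -- Game semantics

  Valid : Subset k → CState → Set ℓ
  Valid M s̄ = (∀ i → i ∈ M → ¬ (lookup s̄ i ⊨ ξ i))
             ⊎ (M ≡ full × (∀ i → lookup s̄ i ⊨ ξ i))

  Step : Subset k → Vec Label k → CState → CState → Set ℓ
  Step M b̄ s̄ s̄′ = (∀ i → i ∈ M → R (lookup s̄ i) (lookup b̄ i) (lookup s̄′ i))
                    × (∀ i → i ∉ M → lookup s̄′ i ≡ lookup s̄ i)

  data GameState : Set ℓ where
    falsifier : CState → GameState
    verifier  : CState → Labels∀ → GameState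

  VerifierMove : CState → Labels∀ → CState → Set ℓ
  VerifierMove s̄ b∀ s̄′ =
    ∃[ M ] ∃[ b∃ ] (Nonempty M × Valid M s̄ × Step M (b∀ ⌢ b∃) s̄ s̄′)

  data _⟶_ : GameState → GameState → Set ℓ where
    falsifierMove : ∀ s̄ b∀ → falsifier s̄ ⟶ verifier s̄ b∀
    verifierMove  : ∀ {s̄ b∀ s̄′} → VerifierMove s̄ b∀ s̄′ → verifier s̄ b∀ ⟶ falsifier s̄′

  InitialState : GameState → Set ℓ
  InitialState (falsifier s̄)  = (∀ i → lookup s̄ i ⊨ Init) × (s̄ ⊨ᶜ ψ)
  InitialState (verifier _ _) = Lift ℓ ⊥

  BadState : GameState → Set ℓ
  BadState (falsifier s̄)  = (∀ i → lookup s̄ i ⊨ ξ i) × ¬ (s̄ ⊨ᶜ ϕ)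
  BadState (verifier _ _) = Lift ℓ ⊥

  -- Plays are maximal: a finite one ends in a state without moves.
  data Play : Set ℓ where
    infinite : (π : ℕ → GameState) →
               InitialState (π 0) →
               (∀ n → π n ⟶ π (1+ n)) → Play
    finite   : (n : ℕ) (π : Fin (1+ n) → GameState) →
               InitialState (π zero) →
               (∀ (i : Fin n) → π (inject₁ i) ⟶ π (fsuc i)) →
               ¬ (∃[ g ] (π (fromℕ n) ⟶ g)) → Play

  WinningPlay : Play → Set ℓ
  WinningPlay (infinite π _ _)   = ∀ n → ¬ BadState (π n)
  WinningPlay (finite _ _ _ _ _) = Lift ℓ ⊥

  Strategy : Set ℓ
  Strategy = ∀ s̄ b∀ → ∃[ s̄′ ] VerifierMove s̄ b∀ s̄′

  Obeys : Strategy → GameState → GameState → Set ℓ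
  Obeys τ g g′ = ∀ s̄ b∀ → g ≡ verifier s̄ b∀ → g′ ≡ falsifier (proj₁ (τ s̄ b∀))

  Follows : Strategy → Play → Set ℓ
  Follows τ (infinite π _ _)   = ∀ n → Obeys τ (π n) (π (1+ n))
  Follows τ (finite n π _ _ _) = ∀ (i : Fin n) → Obeys τ (π (inject₁ i)) (π (fsuc i))

  WinningStrategy : Strategy → Set ℓ
  WinningStrategy τ = ∀ play → Follows τ play → WinningPlay play

  ----------------------------------------------------------------------
  -- The formulas occurring in the clauses, as the relations they denote
  -- in the intended model

  Bad : CState → Set ℓ
  Bad s̄ = (∀ i → lookup s̄ i ⊨ ξ i) × ¬ (s̄ ⊨ᶜ ϕ)

  valid : Subset k → CState → Set ℓ
  valid M s̄ = if does (M ≟full) then none ⊎ every else none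
    where
    none  = ∀ i → i ∈ M → ¬ (lookup s̄ i ⊨ ξ i)
    every = ∀ i → i ∈ M → lookup s̄ i ⊨ ξ i

  Δ : Subset k → CState → CState → Vec Label k → Set ℓ
  Δ M s̄ s̄′ b̄ = (∀ i → i ∈ M → R (lookup s̄ i) (lookup b̄ i) (lookup s̄′ i))
                 × (∀ i → i ∉ M → lookup s̄ i ≡ lookup s̄′ i)

  allowed : Subset k → AbstractLabel → CState → Labels∀ → Set ℓ
  allowed M p s̄ b∀ = ∃[ s̄′ ] ∃[ b∃ ] (Δ M s̄ s̄′ (b∀ ⌢ b∃) × (s̄′ ⊨ᶜ p))

  δ : Subset k → AbstractLabel → CState → CState → Labels∀ → Set ℓ
  δ M p s̄ s̄′ b∀ = (∃[ b∃ ] Δ M s̄ s̄′ (b∀ ⌢ b∃))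
                    × (allowed M p s̄ b∀ → (s̄′ ⊨ᶜ p))

  ----------------------------------------------------------------------
  -- The constrained Horn clauses.  U L♯ M p says that (M , p) ∈ S × L♯;
  -- the values of an interpretation outside U are irrelevant.

  U : List AbstractLabel → Subset k → AbstractLabel → Set
  U L♯ M p = Nonempty M × (p List.∈ L♯)

  Interpretation : Set (suc ℓ)
  Interpretation = Subset k → AbstractLabel → CState → Labels∀ → Set ℓ

  record Solves (L♯ : List AbstractLabel) (D : Interpretation) : Set ℓ where
    field
      initial : ∀ s̄ b∀ →
                (∀ M p → U L♯ M p → D M p s̄ b∀) →
                (∀ i → lookup s̄ i ⊨ Init) → s̄ ⊨ᶜ ψ → ⊥
      bad     : ∀ M p → U L♯ M p → ∀ s̄ b∀ → Bad s̄ → D M p s̄ b∀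
      invalid : ∀ M p → U L♯ M p → ∀ s̄ b∀ → ¬ valid M s̄ → D M p s̄ b∀
      step    : ∀ M p → U L♯ M p → ∀ s̄ s̄′ b∀ b∀′ →
                (∀ M′ p′ → U L♯ M′ p′ → D M′ p′ s̄′ b∀′) →
                δ M p s̄ s̄′ b∀ → D M p s̄ b∀

CHCSatisfiable : ∀ {ℓ} {Sg : Signature} (𝒯 : Theory Sg ℓ) (TS : TransitionSystem Sg)
                 (φ : Property Sg TS) → List (Property.AbstractLabel φ) → Set (suc ℓ)
CHCSatisfiable 𝒯 TS φ L♯ = ∃[ D ] Composition.Solves 𝒯 TS φ L♯ D

-- Satisfaction of φ by TS in the game semantics.
_,_⊨G_ : ∀ {ℓ} {Sg : Signature} (𝒯 : Theory Sg ℓ) (TS : TransitionSystem Sg) →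
         Property Sg TS → Set ℓ
𝒯 , TS ⊨G φ = ∃[ τ ] Composition.WinningStrategy 𝒯 TS φ τ

{-# OPTIONS --safe #-}

-- Let (s̄ , b∀) be promising if some D_{M,p} with (M , p) ∈ U fails there, and s̄
-- safe if it is promising for every b∀.  The first clause makes initial states
-- safe, the second makes promising states not bad.  If D_{M,p} fails at
-- (s̄ , b∀), then M is valid by the third clause, and by the fourth every
-- δ_{M,p}-successor of (s̄ , b∀) is safe; δ_{M,p} has a successor, namely a
-- witness of allowed_{M,p} if there is one, and otherwise any M-successor.
-- So the verifier can keep the play within safe states.
module Submission where

open import Defs
open import Axiom.ExcludedMiddle using (ExcludedMiddle)
open import Axiom.DoubleNegationElimination using (em⇒dne)
open import Data.Empty using (⊥-elim)
open import Data.Fin.Base using (Fin; zero; fromℕ)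
open import Data.Fin.Properties using (¬∀⟶∃¬)
open import Data.Fin.Subset using (Subset; Nonempty; _∈_; _∉_; ⁅_⁆) renaming (⊤ to full)
open import Data.Fin.Subset.Properties using (_∈?_; ∈⊤; x∈⁅x⁆; x∈⁅y⁆⇒x≡y)
open import Data.List.Base using (List)
open import Data.Nat.Base using (NonZero) renaming (suc to 1+)
open import Data.Product using (∃-syntax; _×_; _,_; proj₁; proj₂; map₂)
open import Data.Sum using (inj₁; inj₂)
open import Data.Vec.Base using (Vec; lookup; tabulate; replicate)
open import Data.Vec.Properties using (lookup∘tabulate)
open import Relation.Binary.PropositionalEquality using (_≡_; refl; sym; subst)
open import Relation.Nullary using (¬_; yes; no)

vec-choice : ∀ {a p} {A : Set a} {n} {P : Fin n → A → Set p} →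
             (∀ i → ∃[ x ] P i x) → ∃[ v ] (∀ i → P i (lookup v i))
vec-choice {P = P} f =
  tabulate (λ i → proj₁ (f i)) ,
  λ i → subst (P i) (sym (lookup∘tabulate _ i)) (proj₂ (f i))

full-nonempty : ∀ n .{{_ : NonZero n}} → Nonempty (full {n})
full-nonempty (1+ n) = zero , ∈⊤

module _ {ℓ} (em : ExcludedMiddle ℓ)
         {Sg : Signature} (𝒯 : Theory Sg ℓ) (TS : TransitionSystem Sg)
         (det : Deterministic 𝒯 TS) (φ : Property Sg TS) where
  open Composition 𝒯 TS φ

  -- Nonempty domains give a default wherever any labels will do.
  someLabels : ∀ {n} → Vec Label n
  someLabels = replicate _ (inhabited a)

  -- Determinism supplies the components in `M`, the others stay put, and these independent choices
  -- form one composed state.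
  successor : ∀ M b̄ s̄ → ∃[ s̄′ ] Step M b̄ s̄ s̄′
  successor M b̄ s̄ =
    let s̄′ , moves = vec-choice component
    in s̄′ , (λ i → proj₁ (moves i)) , (λ i → proj₂ (moves i))
    where
    component : ∀ i → ∃[ s′ ] ((i ∈ M → R (lookup s̄ i) (lookup b̄ i) s′)
                               × (i ∉ M → s′ ≡ lookup s̄ i))
    component i with i ∈? M
    ... | yes i∈M = let s′ , r , _ = det (lookup s̄ i) (lookup b̄ i)
                    in s′ , (λ _ → r) , λ i∉M → ⊥-elim (i∉M i∈M)
    ... | no i∉M  = lookup s̄ i , (λ i∈M → ⊥-elim (i∉M i∈M)) , λ _ → refl

  Step⇒Δ : ∀ M b̄ s̄ s̄′ → Step M b̄ s̄ s̄′ → Δ M s̄ s̄′ b̄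
  Step⇒Δ _ _ _ _ = map₂ λ stay i i∉M → sym (stay i i∉M)

  Δ⇒Step : ∀ M b̄ s̄ s̄′ → Δ M s̄ s̄′ b̄ → Step M b̄ s̄ s̄′
  Δ⇒Step _ _ _ _ = map₂ λ stay i i∉M → sym (stay i i∉M)

  valid⇒Valid : ∀ M s̄ → valid M s̄ → Valid M s̄
  valid⇒Valid M s̄ v with M ≟full
  valid⇒Valid M s̄ (inj₁ none)  | yes _    = inj₁ none
  valid⇒Valid M s̄ (inj₂ every) | yes refl = inj₂ (refl , λ i → every i ∈⊤)
  valid⇒Valid M s̄ none         | no _     = inj₁ none

  -- If every `ξ i` holds, the full set is valid; otherwise the singleton of a failing component is.
  someValid : ∀ s̄ → ∃[ M ] (Nonempty M × Valid M s̄)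
  someValid s̄ with em {∀ i → lookup s̄ i ⊨ ξ i}
  ... | yes every = full , full-nonempty k , inj₂ (refl , every)
  ... | no ¬every =
    let i , ¬ξᵢ = ¬∀⟶∃¬ k (λ i → lookup s̄ i ⊨ ξ i) (λ _ → em) ¬every
    in ⁅ i ⁆ , (i , x∈⁅x⁆ i) ,
       inj₁ λ j j∈ → subst (λ j → ¬ (lookup s̄ j ⊨ ξ j)) (sym (x∈⁅y⁆⇒x≡y i j∈)) ¬ξᵢ

  someMove : ∀ s̄ b∀ → ∃[ s̄′ ] VerifierMove s̄ b∀ s̄′
  someMove s̄ b∀ =
    let M , M≢∅ , v = someValid s̄
        s̄′ , st    = successor M (b∀ ⌢ someLabels) s̄
    in s̄′ , M , someLabels , M≢∅ , v , st

  δ-successor : ∀ M p s̄ b∀ → ∃[ s̄′ ] δ M p s̄ s̄′ b∀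
  δ-successor M p s̄ b∀ with em {allowed M p s̄ b∀}
  ... | yes (s̄′ , b∃ , d , holds) = s̄′ , (b∃ , d) , λ _ → holds
  -- The implication in `δ` is vacuous here, so arbitrary existential labels will do.
  ... | no ¬allowed =
    let s̄′ , st = successor M (b∀ ⌢ someLabels) s̄
    in s̄′ , (someLabels , Step⇒Δ M (b∀ ⌢ someLabels) s̄ s̄′ st) , λ al → ⊥-elim (¬allowed al)

  -- Rules out finite plays, which end in a state without moves.
  has-move : Strategy → ∀ g → ∃[ g′ ] (g ⟶ g′)
  has-move τ (falsifier s̄)   = verifier s̄ someLabels , falsifierMove s̄ someLabels
  has-move τ (verifier s̄ b∀) =
    let s̄′ , m = τ s̄ b∀ in falsifier s̄′ , verifierMove m

  module _ (L♯ : List AbstractLabel) (D : Interpretation) (sol : Solves L♯ D) where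
    open Solves sol

    Promising : CState → Labels∀ → Set ℓ
    Promising s̄ b∀ = ∃[ M ] ∃[ p ] (U L♯ M p × ¬ D M p s̄ b∀)

    Safe : CState → Set ℓ
    Safe s̄ = ∀ b∀ → Promising s̄ b∀

    -- The first and last clauses have a conjunction over `U` as premise; refuting it classically
    -- leaves a failing conjunct.
    ¬all⇒Promising : ∀ {s̄ b∀} → ¬ (∀ M p → U L♯ M p → D M p s̄ b∀) → Promising s̄ b∀
    ¬all⇒Promising ¬all =
      em⇒dne em λ ¬pr → ¬all λ M p u → em⇒dne em λ ¬d → ¬pr (M , p , u , ¬d)

    -- Strategies also have to answer outside the promising states.
    response : ∀ s̄ b∀ →
               ∃[ s̄′ ] (VerifierMove s̄ b∀ s̄′ × (Promising s̄ b∀ → Safe s̄′))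
    response s̄ b∀ with em {Promising s̄ b∀}
    ... | no ¬pr =
      let s̄′ , m = someMove s̄ b∀ in s̄′ , m , λ pr → ⊥-elim (¬pr pr)
    ... | yes (M , p , u , ¬d) =
      let s̄′ , d = δ-successor M p s̄ b∀
          (b∃ , Δ-step) , _ = d
          v = em⇒dne em λ ¬v → ¬d (invalid M p u s̄ b∀ ¬v)
      in s̄′ , (M , b∃ , proj₁ u , valid⇒Valid M s̄ v , Δ⇒Step M (b∀ ⌢ b∃) s̄ s̄′ Δ-step) ,
         -- The last clause covers every `b∀′`; the predicate that fails next may depend on it.
         λ _ b∀′ → ¬all⇒Promising λ all → ¬d (step M p u s̄ s̄′ b∀ b∀′ all d)

    strategy : Strategy
    strategy s̄ b∀ = let s̄′ , m , _ = response s̄ b∀ in s̄′ , m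

    -- At its own states the falsifier has yet to choose labels, so all choices must be covered
    -- there.
    Invariant : GameState → Set ℓ
    Invariant (falsifier s̄)   = Safe s̄
    Invariant (verifier s̄ b∀) = Promising s̄ b∀

    invariant-initial : ∀ g → InitialState g → Invariant g
    invariant-initial (falsifier s̄) (init , hψ) b∀ =
      ¬all⇒Promising λ all → initial s̄ b∀ all init hψ

    invariant-step : ∀ {g g′} → g ⟶ g′ → Obeys strategy g g′ → Invariant g → Invariant g′
    invariant-step (falsifierMove s̄ b∀) _ safe = safe b∀
    invariant-step (verifierMove {s̄} {b∀} _) obeys pr with obeys s̄ b∀ refl
    -- Obedience makes the target of the move the answer of `strategy`, so the guarantee of
    -- `response` applies.
    ... | refl = proj₂ (proj₂ (response s̄ b∀)) pr

    -- Badness ignores labels, so a single label tuple suffices to contradict the second clause.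
    invariant⇒¬bad : ∀ g → Invariant g → ¬ BadState g
    invariant⇒¬bad (falsifier s̄) safe hbad =
      let M , p , u , ¬d = safe someLabels in ¬d (bad M p u s̄ someLabels hbad)

    strategy-wins : WinningStrategy strategy
    strategy-wins (infinite π init moves) follows n = invariant⇒¬bad (π n) (inv n)
      where
      inv : ∀ n → Invariant (π n)
      inv 0      = invariant-initial (π 0) init
      inv (1+ n) = invariant-step (moves n) (follows n) (inv n)
    strategy-wins (finite n π _ _ stuck) _ =
      ⊥-elim (stuck (has-move strategy (π (fromℕ n))))

corollary6p12 : ∀ {ℓ} → ExcludedMiddle ℓ →
    {Sg : Signature} (𝒯 : Theory Sg ℓ) (TS : TransitionSystem Sg) →
    Deterministic 𝒯 TS →
    (φ : Property Sg TS) (L♯ : List (Property.AbstractLabel φ)) →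
    CHCSatisfiable 𝒯 TS φ L♯ →
    𝒯 , TS ⊨G φ
corollary6p12 em 𝒯 TS det φ L♯ (D , sol) =
  strategy em 𝒯 TS det φ L♯ D sol , strategy-wins em 𝒯 TS det φ L♯ D sol
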